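{- Let $G$ be a König–Egerváry graph. Then: (i) $G-v$ is a König–Egerváry graph for every $v\in V(G)-\mathrm{core}(G)$; (ii) $G-v$ is not a König–Egerváry graph for every $v\in\mathrm{core}(G)-\ker(G)$; moreover, for such $v$, $G-v$ is a $1$-König–Egerváry graph; (iii) $G-v$ is a König–Egerváry graph for every $v\in\ker(G)$; (iv) $\varrho_v(G)=n(G)-\xi(G)+\varepsilon(G)$.
   Context: All graphs are finite, undirected, without loops or multiple edges; $n(G)=|V(G)|$. $\alpha(G)$ is the maximum size of an independent set of $G$ and $\mu(G)$ is the maximum size of a matching of $G$. $G$ is a König–Egerváry graph if $\alpha(G)+\mu(G)=n(G)$, and a $1$-König–Egerváry graph if $\alpha(G)+\mu(G)=n(G)-1$ (the graph with no vertices satisfies the first equality). For $A\subseteq V(G)$, $N(A)$ is the set of vertices having at least one neighbor in $A$. $d(G)=\max\{|A|-|N(A)|:A\subseteq V(G)\}$ is the critical difference (the maximum is also attained over independent sets), and an independent set $A$ (possibly empty) is a critical independent set if $|A|-|N(A)|=d(G)$. $\ker(G)$ is the intersection of all critical independent sets of $G$, and $\varepsilon(G)=|\ker(G)|$. $\mathrm{core}(G)$ is the intersection of all maximum independent sets of $G$, and $\xi(G)=|\mathrm{core}(G)|$. $G-v$ is the graph obtained by deleting the vertex $v$. $\varrho_v(G)$ is the number of vertices $v\in V(G)$ such that $G-v$ is a König–Egerváry graph. -}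

module Defs where

open import Data.Fin.Base using (Fin; punchIn) renaming (_<_ to _<ᶠ_)
open import Data.Fin.Properties using (all?; any?) renaming (_≟_ to _≟ᶠ_; _<?_ to _<ᶠ?_)
open import Data.Fin.Subset using (Subset; inside; outside; _∈_; ∣_∣; ⋂)
open import Data.Fin.Subset.Properties using (_∈?_)
open import Data.Integer.Base using (ℤ; 0ℤ; _⊖_)
open import Data.Integer.Properties using () renaming (_≟_ to _≟ᶻ_; ≤-totalOrder to ≤ᶻ-totalOrder)
import Data.List.Extrema as Extrema
import Data.List.Extrema.Nat as ℕ-Extrema
open import Data.List.Base using (List; []; _∷_; _++_; map; filter; length; allFin; cartesianProduct)
open import Data.List.Relation.Unary.AllPairs using (AllPairs; allPairs?)
open import Data.Nat.Base using (ℕ; zero; suc; pred; _+_)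
open import Data.Nat.Properties using (_≟_)
open import Data.Product.Base using (_×_; _,_; ∃-syntax)
open import Data.Vec.Base using ([]; _∷_; tabulate)
open import Level using (0ℓ)
open import Relation.Binary.Core using (Rel)
open import Relation.Binary.Definitions using (Decidable; Symmetric; Irreflexive)
open import Relation.Binary.PropositionalEquality.Core using (_≡_; _≢_; refl)
open import Relation.Nullary using (Dec; ¬_; does)
open import Relation.Nullary.Decidable using (_×-dec_; _→-dec_; ¬?)
import Relation.Unary as U

private
  variable
    n : ℕ
    A : Set

-- The vertex set is Fin n, so the index n is the order n(G).
record SimpleGraph (n : ℕ) : Set₁ where
  field
    Adj    : Rel (Fin n) 0ℓ
    adj?   : Decidable Adj
    sym    : Symmetric Adj
    irrefl : Irreflexive _≡_ Adj

open SimpleGraph public using (Adj; adj?)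

-- The remaining vertices of G − v are renumbered by Fin (n − 1) through
-- punchIn v, the order-preserving injection whose image omits exactly v.
delete : SimpleGraph n → Fin n → SimpleGraph (pred n)
delete {suc n} G v = record
  { Adj    = λ i j → Adj G (punchIn v i) (punchIn v j)
  ; adj?   = λ i j → adj? G (punchIn v i) (punchIn v j)
  ; sym    = SimpleGraph.sym G
  ; irrefl = λ { refl → SimpleGraph.irrefl G refl }
  }

comprehension : {P : U.Pred (Fin n) 0ℓ} → U.Decidable P → Subset n
comprehension P? = tabulate (λ v → does (P? v))

subsets : ∀ n → List (Subset n)
subsets zero    = [] ∷ []
subsets (suc n) = map (outside ∷_) (subsets n) ++ map (inside ∷_) (subsets n)

sublists : List A → List (List A)
sublists []       = [] ∷ []
sublists (x ∷ xs) = sublists xs ++ map (x ∷_) (sublists xs)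

module _ (G : SimpleGraph n) where

  Independent : Subset n → Set
  Independent S = ∀ u v → u ∈ S → v ∈ S → ¬ Adj G u v

  independent? : U.Decidable Independent
  independent? S =
    all? λ u → all? λ v → (u ∈? S) →-dec ((v ∈? S) →-dec ¬? (adj? G u v))

  -- The default value 0 of the maximum is harmless here, and likewise in μ
  -- and d below: it is the value attained by the empty set.
  α : ℕ
  α = ℕ-Extrema.max 0 (map ∣_∣ (filter independent? (subsets n)))

  IsMaximumIndependent : Subset n → Set
  IsMaximumIndependent S = Independent S × ∣ S ∣ ≡ α

  isMaximumIndependent? : U.Decidable IsMaximumIndependent
  isMaximumIndependent? S = independent? S ×-dec (∣ S ∣ ≟ α)

  core : Subset n
  core = ⋂ (filter isMaximumIndependent? (subsets n))

  ξ : ℕ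
  ξ = ∣ core ∣

  -- Each edge is listed exactly once, with its smaller endpoint first.
  edges : List (Fin n × Fin n)
  edges = filter (λ (i , j) → (i <ᶠ? j) ×-dec adj? G i j)
                 (cartesianProduct (allFin n) (allFin n))

  DisjointEdges : Rel (Fin n × Fin n) 0ℓ
  DisjointEdges (a , b) (c , d) = (a ≢ c × a ≢ d) × (b ≢ c × b ≢ d)

  disjointEdges? : Decidable DisjointEdges
  disjointEdges? (a , b) (c , d) =
    (¬? (a ≟ᶠ c) ×-dec ¬? (a ≟ᶠ d)) ×-dec (¬? (b ≟ᶠ c) ×-dec ¬? (b ≟ᶠ d))

  -- The edge list has no repetitions, so its sublists are the sets of edges.
  matchings : List (List (Fin n × Fin n))
  matchings = filter (allPairs? disjointEdges?) (sublists edges)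

  μ : ℕ
  μ = ℕ-Extrema.max 0 (map length matchings)

  neighbour? : (S : Subset n) → U.Decidable (λ v → ∃[ u ] (u ∈ S × Adj G v u))
  neighbour? S v = any? λ u → (u ∈? S) ×-dec adj? G v u

  N : Subset n → Subset n
  N S = comprehension (neighbour? S)

  -- |S| − |N(S)| may be negative, so it is taken in ℤ.
  difference : Subset n → ℤ
  difference S = ∣ S ∣ ⊖ ∣ N S ∣

  d : ℤ
  d = Extrema.max ≤ᶻ-totalOrder 0ℤ (map difference (subsets n))

  IsCriticalIndependent : Subset n → Set
  IsCriticalIndependent S = Independent S × difference S ≡ d

  isCriticalIndependent? : U.Decidable IsCriticalIndependent
  isCriticalIndependent? S = independent? S ×-dec (difference S ≟ᶻ d)

  ker : Subset n
  ker = ⋂ (filter isCriticalIndependent? (subsets n))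

  ε : ℕ
  ε = ∣ ker ∣

  KönigEgerváry : Set
  KönigEgerváry = α + μ ≡ n

  könig-egerváry? : Dec KönigEgerváry
  könig-egerváry? = α + μ ≟ n

  -- α + μ = n − 1, written without truncated subtraction so that it fails
  -- for the graph with no vertices.
  1-KönigEgerváry : Set
  1-KönigEgerváry = suc (α + μ) ≡ n

ϱᵥ : SimpleGraph n → ℕ
ϱᵥ G = ∣ comprehension (λ v → könig-egerváry? (delete G v)) ∣

{-# OPTIONS --safe #-}
-- A matching M gives |A| − |N(A)| ≤ n − 2|M| for every vertex set A, strictly if
-- some vertex outside A is missed by M. Hence, in a Kőnig–Egerváry graph, d = n − 2μ,
-- every maximum independent set S is critical (so ker ⊆ core), and a vertex missed by
-- a maximum matching lies in ker. Conversely, follow alternating paths from v ∈ ker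
-- within a maximum matching, which joins the complement of S to S. Either flipping one
-- of them frees v, or the set R of vertices of S reached is entirely matched and S ∖ R
-- is a critical independent set that omits v, which is impossible.
-- Deleting v lowers α by one exactly if v ∈ core, and keeps μ exactly if some maximum
-- matching misses v; comparing these two gives the theorem.

module Submission where

open import Defs
open import Data.Bool.Base using (true; false)
open import Data.Fin.Base using (Fin; zero; suc; punchIn; punchOut) renaming (_<_ to _<ᶠ_)
open import Data.Fin.Properties
  using (any?; <-cmp; punchIn-injective; punchInᵢ≢i; punchIn-punchOut)
  renaming (_≟_ to _≟ᶠ_; suc-injective to suc-injectiveᶠ; _<?_ to _<ᶠ?_)
open import Data.Fin.Subset
  using (Subset; inside; outside; ⊥; ∁; ∣_∣; ⋂; _∩_; _∈_; _∉_)
open import Data.Fin.Subset.Properties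
  using (_∈?_; ∉⊥; ∈⊤; ∣⊥∣≡0; ∣p∣≤n; p⊆q⇒∣p∣≤∣q∣; x∈p∩q⁺; x∈p∩q⁻; ∣∁p∣≡n∸∣p∣;
         x∈∁p⇒x∉p; x∉p⇒x∈∁p)
open import Data.Integer.Base using (_⊖_; 0ℤ) renaming (_≤_ to _≤ᶻ_; _<_ to _<ᶻ_)
import Data.Integer.Properties as ℤ
open import Data.List.Base using (List; []; _∷_; _++_; length; map; filter; allFin; cartesianProduct)
import Data.List.Extrema ℤ.≤-totalOrder as ℤ-Extrema
import Data.List.Extrema.Nat as ℕ-Extrema
open import Data.List.Membership.Propositional using (find)
  renaming (_∈_ to _∈ₗ_)
open import Data.List.Membership.Propositional.Properties
  using (∈-∃++; ∈-map⁺; ∈-map⁻; ∈-++⁺ˡ; ∈-++⁺ʳ; ∈-++⁻; ∈-filter⁺; ∈-filter⁻;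
         ∈-cartesianProduct⁺; ∈-allFin)
open import Data.List.Properties using (length-map; length-++; filter-all)
open import Data.List.Relation.Binary.Disjoint.Propositional using (Disjoint)
open import Data.List.Relation.Binary.Permutation.Propositional
  using (_↭_; ↭-refl; ↭-sym; ↭-trans; ↭-prep; ↭⇒↭ₛ)
open import Data.List.Relation.Binary.Permutation.Propositional.Properties
  using (↭-length; shift; ∈-resp-↭; All-resp-↭) renaming (map⁺ to ↭-map⁺)
import Data.List.Relation.Binary.Permutation.Setoid.Properties as Permutationₛ
open import Data.List.Relation.Unary.All as All using (All; []; _∷_)
import Data.List.Relation.Unary.All.Properties as All
open import Data.List.Relation.Unary.AllPairs as AllPairs using (AllPairs; []; _∷_; allPairs?)
import Data.List.Relation.Unary.AllPairs.Properties as AllPairs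
open import Data.List.Relation.Unary.Any as Any using (here; there)
open import Data.List.Relation.Unary.Unique.Propositional using (Unique)
import Data.List.Relation.Unary.Unique.Propositional.Properties as Unique
open import Data.Nat.Base using (ℕ; zero; suc; _+_; _*_; _∸_; _≤_; _<_; z≤n; s≤s; s≤s⁻¹)
open import Data.Nat.Properties
  using (+-comm; +-suc; +-cancelʳ-≤; +-mono-≤; +-monoˡ-≤; +-monoʳ-≤; *-cancelˡ-≤;
         ≤-reflexive; ≤-trans; ≤-antisym; ≮⇒≥; 1+n≰n; m∸n+n≡m;
         suc-injective; n≤0⇒n≡0; ≤∧≢⇒<)
open import Data.Nat.Tactic.RingSolver using (solve-∀)
open import Data.Product.Base using (_×_; _,_; proj₁; proj₂; swap; uncurry; ∃; ∃-syntax)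
open import Data.Product.Properties using (≡-dec)
open import Data.Sum.Base as Sum using (_⊎_; inj₁; inj₂; [_,_]′)
open import Data.Vec.Base using ([]; _∷_; here; there)
open import Data.Vec.Properties using (lookup∘tabulate; []=⇒lookup; lookup⇒[]=)
open import Function.Base using (_∘_; id)
open import Level using (0ℓ)
open import Relation.Binary.Core using (Rel)
open import Relation.Binary.Definitions using (Decidable; tri<; tri≈; tri>)
open import Relation.Binary.PropositionalEquality
  using (_≡_; _≢_; refl; sym; trans; cong; cong₂; subst; subst₂; ≢-sym; setoid)
open import Relation.Nullary using (yes; no; does; ¬_; contradiction)
open import Relation.Nullary.Decidable using (dec-true; dec-false; _×-dec_; _⊎-dec_; ¬?; decidable-stable)
import Relation.Unary as U

private
  variable
    n : ℕ
    A B : Set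
    x y : A
    xs ys : List A

-- Additive inequalities and differences of natural numbers

-- Linear arithmetic by hand: several inequalities are added up to `p ≤ q`, the ring solver exhibits
-- a common summand `c` on both sides, and `c` is cancelled.
≤-from-sum : ∀ {p q x y} c → p ≤ q → x + c ≡ p → q ≡ y + c → x ≤ y
≤-from-sum {x = x} {y} c p≤q refl refl = +-cancelʳ-≤ c x y p≤q

+-cancel-⊖ : ∀ p q r → (p + r) ⊖ (q + r) ≡ p ⊖ q
+-cancel-⊖ p q r = trans (cong₂ _⊖_ (+-comm p r) (+-comm q r)) (ℤ.+-cancelˡ-⊖ r p q)

-- Both differences are brought to the common subtrahend `d + b`, where only the minuends remain to
-- be compared.
⊖-≤⁺ : ∀ a b c d → a + d ≤ c + b → a ⊖ b ≤ᶻ c ⊖ d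
⊖-≤⁺ a b c d h = subst₂ _≤ᶻ_
  (trans (cong (a + d ⊖_) (+-comm d b)) (+-cancel-⊖ a b d)) (+-cancel-⊖ c d b)
  (ℤ.⊖-monoˡ-≤ (d + b) h)

⊖-≤⁻ : ∀ a b c d → a ⊖ b ≤ᶻ c ⊖ d → a + d ≤ c + b
⊖-≤⁻ a b c d h = ≮⇒≥ λ lt → ℤ.≤⇒≯ h (subst₂ _<ᶻ_
  (+-cancel-⊖ c d b) (trans (cong (a + d ⊖_) (+-comm d b)) (+-cancel-⊖ a b d))
  (ℤ.⊖-monoˡ-< (d + b) lt))

-- Counting with lists

-- Pigeonhole principle: each head of `xs` uses up one occurrence in `ys`. Most comparisons of
-- cardinalities below reduce to it.
length-⊆ : Unique xs → (∀ {x} → x ∈ₗ xs → x ∈ₗ ys) → length xs ≤ length ys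
length-⊆ [] xs⊆ys = z≤n
length-⊆ {xs = x ∷ xs} (x∉xs ∷ u) xs⊆ys with ∈-∃++ (xs⊆ys (here refl))
... | ps , qs , refl = subst (suc (length xs) ≤_) (sym (↭-length (shift x ps qs)))
  (s≤s (length-⊆ u λ z∈xs → skip z∈xs (∈-resp-↭ (shift x ps qs) (xs⊆ys (there z∈xs)))))
  where
  skip : ∀ {z} → z ∈ₗ xs → z ∈ₗ x ∷ ps ++ qs → z ∈ₗ ps ++ qs
  skip z∈xs (here refl) = contradiction refl (All.lookup x∉xs z∈xs)
  skip z∈xs (there z∈)  = z∈

allPairs-unique : {R : Rel A 0ℓ} → Unique xs →
                  (∀ {x y} → x ∈ₗ xs → y ∈ₗ xs → x ≢ y → R x y) → AllPairs R xs
allPairs-unique []       h = []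
allPairs-unique (x≢ ∷ u) h = All.tabulate (λ y∈ → h (here refl) (there y∈) (All.lookup x≢ y∈))
  ∷ allPairs-unique u (λ x∈ y∈ → h (there x∈) (there y∈))

map-unique-injective : ∀ {f : A → B} {xs} → Unique (map f xs) →
                       x ∈ₗ xs → y ∈ₗ xs → f x ≡ f y → x ≡ y
map-unique-injective (_ ∷ _)  (here refl) (here refl) eq = refl
map-unique-injective {f = f} (fx∉ ∷ _) (here refl) (there y∈) eq =
  contradiction eq (All.lookup fx∉ (∈-map⁺ f y∈))
map-unique-injective {f = f} (fy∉ ∷ _) (there x∈) (here refl) eq =
  contradiction (sym eq) (All.lookup fy∉ (∈-map⁺ f x∈))
map-unique-injective (_ ∷ u)  (there x∈)  (there y∈)  eq = map-unique-injective u x∈ y∈ eq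

module _ {P : U.Pred A 0ℓ} (P? : U.Decidable P) where

  length-filter-split : ∀ xs → length (filter P? xs) + length (filter (¬? ∘ P?) xs) ≡ length xs
  length-filter-split [] = refl
  length-filter-split (x ∷ xs) with ih ← length-filter-split xs | does (P? x)
  ... | true  = cong suc ih
  ... | false = trans (+-suc _ _) (cong suc ih)

  unique-map-filter : {f : A → B} → ∀ {xs} → Unique (map f xs) → Unique (map f (filter P? xs))
  unique-map-filter u = AllPairs.map⁺ (AllPairs.filter⁺ P? (AllPairs.map⁻ u))

  filter∈sublists : ∀ xs → filter P? xs ∈ₗ sublists xs
  filter∈sublists [] = here refl
  filter∈sublists (x ∷ xs) with ih ← filter∈sublists xs | does (P? x)
  ... | true  = ∈-++⁺ʳ (sublists xs) (∈-map⁺ (x ∷_) ih)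
  ... | false = ∈-++⁺ˡ ih

sublists-⊆ : ∀ xs {ys : List A} → ys ∈ₗ sublists xs → ∀ {y} → y ∈ₗ ys → y ∈ₗ xs
sublists-⊆ [] (here refl) ()
sublists-⊆ (x ∷ xs) ys∈ y∈ys with ∈-++⁻ (sublists xs) ys∈
... | inj₁ ys∈xs = there (sublists-⊆ xs ys∈xs y∈ys)
... | inj₂ ys∈map with ∈-map⁻ (x ∷_) ys∈map
...   | zs , zs∈ , refl with y∈ys
...     | here refl  = here refl
...     | there y∈zs = there (sublists-⊆ xs zs∈ y∈zs)

-- Turns a subset into a duplicate-free list, so that its size can be compared with that of a list
-- of endpoints of edges.
elements : Subset n → List (Fin n)
elements []            = []
elements (outside ∷ S) = map suc (elements S)
elements (inside  ∷ S) = zero ∷ map suc (elements S)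

length-elements : (S : Subset n) → length (elements S) ≡ ∣ S ∣
length-elements []            = refl
length-elements (outside ∷ S) = trans (length-map suc (elements S)) (length-elements S)
length-elements (inside  ∷ S) = cong suc (trans (length-map suc (elements S)) (length-elements S))

∈-elements⁺ : {S : Subset n} {v : Fin n} → v ∈ S → v ∈ₗ elements S
∈-elements⁺ {S = inside  ∷ S} here        = here refl
∈-elements⁺ {S = inside  ∷ S} (there v∈S) = there (∈-map⁺ suc (∈-elements⁺ v∈S))
∈-elements⁺ {S = outside ∷ S} (there v∈S) = ∈-map⁺ suc (∈-elements⁺ v∈S)

∈-elements⁻ : (S : Subset n) {v : Fin n} → v ∈ₗ elements S → v ∈ S
∈-elements⁻ (outside ∷ S) v∈ with ∈-map⁻ suc v∈
... | w , w∈ , refl = there (∈-elements⁻ S w∈)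
∈-elements⁻ (inside ∷ S) (here refl) = here
∈-elements⁻ (inside ∷ S) (there v∈) with ∈-map⁻ suc v∈
... | w , w∈ , refl = there (∈-elements⁻ S w∈)

elements-unique : (S : Subset n) → Unique (elements S)
elements-unique []            = []
elements-unique (outside ∷ S) = Unique.map⁺ suc-injectiveᶠ (elements-unique S)
elements-unique (inside  ∷ S) =
  All.map⁺ (All.tabulate λ _ ()) ∷ Unique.map⁺ suc-injectiveᶠ (elements-unique S)

length≤∣∣ : {S : Subset n} {xs : List (Fin n)} →
            Unique xs → (∀ {x} → x ∈ₗ xs → x ∈ S) → length xs ≤ ∣ S ∣
length≤∣∣ {S = S} u xs⊆S = subst (_ ≤_) (length-elements S) (length-⊆ u (∈-elements⁺ ∘ xs⊆S))

∣∣≤length : {S : Subset n} {xs : List (Fin n)} → (∀ {x} → x ∈ S → x ∈ₗ xs) → ∣ S ∣ ≤ length xs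
∣∣≤length {S = S} S⊆xs =
  subst (_≤ _) (length-elements S) (length-⊆ (elements-unique S) (S⊆xs ∘ ∈-elements⁻ S))

∣∣-union : {C P Q : Subset n} → (∀ {v} → v ∈ C → v ∈ P ⊎ v ∈ Q) →
           (∀ {v} → v ∈ P → v ∈ C) → (∀ {v} → v ∈ Q → v ∈ C) → (∀ {v} → v ∈ P → v ∉ Q) →
           ∣ C ∣ ≡ ∣ P ∣ + ∣ Q ∣
∣∣-union {C = C} {P} {Q} C⊆ P⊆ Q⊆ disjoint = trans
  (≤-antisym
    (∣∣≤length ([ ∈-++⁺ˡ ∘ ∈-elements⁺ , ∈-++⁺ʳ (elements P) ∘ ∈-elements⁺ ]′ ∘ C⊆))
    (length≤∣∣
      (Unique.++⁺ (elements-unique P) (elements-unique Q)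
        λ (x∈P , x∈Q) → disjoint (∈-elements⁻ P x∈P) (∈-elements⁻ Q x∈Q))
      ([ P⊆ ∘ ∈-elements⁻ P , Q⊆ ∘ ∈-elements⁻ Q ]′ ∘ ∈-++⁻ (elements P))))
  (trans (length-++ (elements P)) (cong₂ _+_ (length-elements P) (length-elements Q)))

∣∁∣+∣∣≡n : (S : Subset n) → ∣ ∁ S ∣ + ∣ S ∣ ≡ n
∣∁∣+∣∣≡n S = trans (cong (_+ ∣ S ∣) (∣∁p∣≡n∸∣p∣ S)) (m∸n+n≡m (∣p∣≤n S))

-- Comprehensions and intersections of families of subsets

module _ {P : U.Pred (Fin n) 0ℓ} (P? : U.Decidable P) where

  ∈-comprehension⁺ : ∀ {v} → P v → v ∈ comprehension P?
  ∈-comprehension⁺ {v} pv =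
    lookup⇒[]= v _ (trans (lookup∘tabulate _ v) (dec-true (P? v) pv))

  ∈-comprehension⁻ : ∀ {v} → v ∈ comprehension P? → P v
  ∈-comprehension⁻ {v} v∈ with P? v in eq
  ... | yes pv = pv
  ... | no ¬pv = contradiction
    (trans (sym ([]=⇒lookup v∈)) (trans (lookup∘tabulate _ v) (dec-false (P? v) ¬pv))) λ ()

∈-subsets : (S : Subset n) → S ∈ₗ subsets n
∈-subsets []            = here refl
∈-subsets (outside ∷ S) = ∈-++⁺ˡ (∈-map⁺ (outside ∷_) (∈-subsets S))
∈-subsets (inside  ∷ S) = ∈-++⁺ʳ (map (outside ∷_) (subsets _)) (∈-map⁺ (inside ∷_) (∈-subsets S))

∈-⋂⁺ : ∀ (Ss : List (Subset n)) {v} → All (v ∈_) Ss → v ∈ ⋂ Ss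
∈-⋂⁺ []       []           = ∈⊤
∈-⋂⁺ (S ∷ Ss) (v∈S ∷ v∈Ss) = x∈p∩q⁺ (v∈S , ∈-⋂⁺ Ss v∈Ss)

∈-⋂⁻ : ∀ (Ss : List (Subset n)) {v} → v ∈ ⋂ Ss → All (v ∈_) Ss
∈-⋂⁻ []       v∈ = []
∈-⋂⁻ (S ∷ Ss) v∈ with x∈p∩q⁻ S (⋂ Ss) v∈
... | v∈S , v∈⋂ = v∈S ∷ ∈-⋂⁻ Ss v∈⋂

module _ {P : U.Pred (Subset n) 0ℓ} (P? : U.Decidable P) {v : Fin n} where

  -- Kept general in `P` because `core` and `ker` are both intersections of this form.
  ∈-⋂-filter⁻ : v ∈ ⋂ (filter P? (subsets n)) → ∀ {S} → P S → v ∈ S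
  ∈-⋂-filter⁻ v∈ {S} pS = All.lookup (∈-⋂⁻ _ v∈) (∈-filter⁺ P? (∈-subsets S) pS)

  ∉-⋂-filter⁻ : v ∉ ⋂ (filter P? (subsets n)) → ∃[ S ] P S × v ∉ S
  ∉-⋂-filter⁻ v∉ with find (All.¬All⇒Any¬ (v ∈?_) _ (v∉ ∘ ∈-⋂⁺ _))
  ... | S , S∈ , v∉S = S , proj₂ (∈-filter⁻ P? {xs = subsets n} S∈) , v∉S

-- Alternating paths

-- Neither predicate has to be decidable: the sum given at each index makes the choice.
some-or-all : ∀ {n} {P Q : Fin n → Set} → (∀ i → P i ⊎ Q i) → ∃ P ⊎ (∀ i → Q i)
some-or-all {zero}  h = inj₂ λ ()
some-or-all {suc n} h with h zero | some-or-all (h ∘ suc)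
... | inj₁ p | _            = inj₁ (zero , p)
... | inj₂ q | inj₁ (i , p) = inj₁ (suc i , p)
... | inj₂ q | inj₂ qs      = inj₂ λ { zero → q ; (suc i) → qs i }

-- `M` is a matching between a left and a right side. Asking for the same right endpoints up to
-- order preserves the number of pairs and the distinctness of those endpoints. `Blocked` is the
-- obstruction: every vertex of `R` is matched, and all candidates to replace it at its partner lie
-- in `R` again.
Reroute Blocked : Rel (Fin n) 0ℓ → List (Fin n × Fin n) → Fin n → Set
Reroute E M v = ∃[ M′ ] Unique (map proj₁ M′) × All (uncurry E) M′
              × All (λ e → v ≢ proj₁ e) M′ × map proj₂ M′ ↭ map proj₂ M
Blocked E M v = ∃[ R ] v ∈ R × (∀ {r} → r ∈ R → ∃[ b ] (r , b) ∈ₗ M × (∀ {s} → E s b → s ∈ R))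

-- R is the set of vertices reachable from v by alternating paths.  The induction removes
-- the pair (v , b) from M and goes on from every other s that could be matched to b.
reroute-or-blocked : {E : Rel (Fin n) 0ℓ} → Decidable E → ∀ k M → length M ≡ k →
  Unique (map proj₁ M) → All (uncurry E) M → ∀ v → Reroute E M v ⊎ Blocked E M v
reroute-or-blocked {n = n} {E = E} E? k M |M| u es v with Any.any? (λ e → v ≟ᶠ proj₁ e) M
... | no ¬any = inj₁ (M , u , es , All.¬Any⇒All¬ M ¬any , ↭-refl)
... | yes any with find any
... | (_ , b) , e∈M , refl with ∈-∃++ e∈M
... | ps , qs , refl = by-length k |M|
  where
  M₁ = ps ++ qs

  M↭ : M ↭ (v , b) ∷ M₁
  M↭ = shift (v , b) ps qs

  -- Besides losing its pair, `v` is barred as a left endpoint, so that no later rerouting matches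
  -- it again.
  E′ : Rel (Fin n) 0ℓ
  E′ s c = E s c × v ≢ s

  u₁ : Unique (map proj₁ ((v , b) ∷ M₁))
  u₁ = Permutationₛ.Unique-resp-↭ (setoid (Fin n)) (↭⇒↭ₛ (↭-map⁺ proj₁ M↭)) u

  es₁ : All (uncurry E) ((v , b) ∷ M₁)
  es₁ = All-resp-↭ M↭ es

  M₁⊆M : ∀ {e} → e ∈ₗ M₁ → e ∈ₗ M
  M₁⊆M e∈ = ∈-resp-↭ (↭-sym M↭) (there e∈)

  by-length : ∀ k → length M ≡ k → Reroute E M v ⊎ Blocked E M v
  by-length zero    |M| = contradiction (trans (sym (↭-length M↭)) |M|) λ ()
  by-length (suc k) |M| = Sum.map freed stuck (some-or-all from)
    where
    -- Membership of `s` is conditional, so that an `s` that cannot be matched to `b` may take the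
    -- empty set.
    Stuck : Fin n → Set
    Stuck s = ∃[ R ] (E′ s b → s ∈ R)
            × (∀ {r} → r ∈ R → ∃[ c ] (r , c) ∈ₗ M₁ × (∀ {t} → E′ t c → t ∈ R))

    from : ∀ s → (E′ s b × Reroute E′ M₁ s) ⊎ Stuck s
    from s with E? s b ×-dec ¬? (v ≟ᶠ s)
    ... | no ¬e = inj₂ (⊥ , (λ e → contradiction e ¬e) , λ r∈⊥ → contradiction r∈⊥ ∉⊥)
    ... | yes e = Sum.map (e ,_) (λ (R , s∈R , closed) → R , (λ _ → s∈R) , closed)
      (reroute-or-blocked (λ t c → E? t c ×-dec ¬? (v ≟ᶠ t)) k M₁
        (suc-injective (trans (sym (↭-length M↭)) |M|)) (AllPairs.tail u₁)
        (All.zip (All.tail es₁ , All.map⁻ (AllPairs.head u₁))) s)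

    -- Once `s` is free, it takes over the partner `b` of `v`.
    freed : (∃[ s ] E′ s b × Reroute E′ M₁ s) → Reroute E M v
    freed (s , (e , v≢s) , M′ , u′ , es′ , s∉ , p) =
      (s , b) ∷ M′ , All.map⁺ s∉ ∷ u′ , e ∷ All.map proj₁ es′ , v≢s ∷ All.map proj₂ es′ ,
      ↭-trans (↭-prep b p) (↭-sym (↭-map⁺ proj₂ M↭))

    stuck : (∀ s → Stuck s) → Blocked E M v
    stuck st = comprehension R? , ∈-comprehension⁺ R? (inj₁ refl) , closed ∘ ∈-comprehension⁻ R?
      where
      -- The blocked set is `v` together with the union of the sets obtained from all `s`. `E` and
      -- `E′` differ only at `v`, which this set contains.
      R? : U.Decidable (λ x → v ≡ x ⊎ ∃[ s ] x ∈ proj₁ (st s))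
      R? x = (v ≟ᶠ x) ⊎-dec any? (λ s → x ∈? proj₁ (st s))

      absorb : ∀ {t c} → E t c → (v ≢ t → ∃[ s ] t ∈ proj₁ (st s)) → t ∈ comprehension R?
      absorb {t} e h with v ≟ᶠ t
      ... | yes v≡t = ∈-comprehension⁺ R? (inj₁ v≡t)
      ... | no  v≢t = ∈-comprehension⁺ R? (inj₂ (h v≢t))

      closed : ∀ {r} → v ≡ r ⊎ (∃[ s ] r ∈ proj₁ (st s)) →
               ∃[ c ] (r , c) ∈ₗ M × (∀ {t} → E t c → t ∈ comprehension R?)
      closed (inj₁ refl) = b , e∈M , λ {t} e →
        absorb e λ v≢t → t , proj₁ (proj₂ (st t)) (e , v≢t)
      closed (inj₂ (s , r∈)) with proj₂ (proj₂ (st s)) r∈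
      ... | c , rc∈M₁ , h = c , M₁⊆M rc∈M₁ , λ e → absorb e λ v≢t → s , h (e , v≢t)

-- Matchings

-- More liberal than membership in `matchings`: the edges may come in any order and with either
-- endpoint first.
IsMatching : SimpleGraph n → List (Fin n × Fin n) → Set
IsMatching G M = All (uncurry (Adj G)) M × AllPairs (DisjointEdges G) M

Avoids : Fin n → List (Fin n × Fin n) → Set
Avoids v = All (λ (a , b) → v ≢ a × v ≢ b)

-- Both orientations of each edge. For a matching, every covered vertex then occurs exactly once as
-- a first and once as a second component.
darts : List (A × A) → List (A × A)
darts []            = []
darts ((a , b) ∷ M) = (a , b) ∷ (b , a) ∷ darts M

length-darts : (M : List (A × A)) → length (darts M) ≡ 2 * length M
length-darts []      = refl
length-darts (_ ∷ M) = trans (cong (2 +_) (length-darts M)) (double (length M))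
  where
  double : ∀ k → 2 + 2 * k ≡ 2 * suc k
  double = solve-∀

all-darts : {R : Rel A 0ℓ} → (∀ {a b} → R a b → R b a) → {M : List (A × A)} →
            All (uncurry R) M → All (uncurry R) (darts M)
all-darts R-sym []       = []
all-darts R-sym (r ∷ rs) = r ∷ R-sym r ∷ all-darts R-sym rs

avoids-darts : ∀ {v : Fin n} {M} → Avoids v M → Avoids v (darts M)
avoids-darts = all-darts swap

module _ (G : SimpleGraph n) where

  adj-≢ : ∀ {a b} → Adj G a b → a ≢ b
  adj-≢ ab a≡b = SimpleGraph.irrefl G a≡b ab

  darts-unique : ∀ {M} → IsMatching G M → Unique (map proj₁ (darts M)) × Unique (map proj₂ (darts M))
  darts-unique {[]} _ = [] , []
  darts-unique {(a , b) ∷ M} (ab ∷ adj , dis ∷ diss) =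
      (adj-≢ ab ∷ All.map⁺ (All.map proj₁ a∉)) ∷ All.map⁺ (All.map proj₁ b∉) ∷ proj₁ ih
    , (≢-sym (adj-≢ ab) ∷ All.map⁺ (All.map proj₂ b∉)) ∷ All.map⁺ (All.map proj₂ a∉) ∷ proj₂ ih
    where
    ih = darts-unique {M} (adj , diss)
    a∉ : Avoids a (darts M)
    a∉ = avoids-darts (All.map proj₁ dis)
    b∉ : Avoids b (darts M)
    b∉ = avoids-darts (All.map proj₂ dis)

  edge? : U.Decidable (λ ((i , j) : Fin n × Fin n) → i <ᶠ j × Adj G i j)
  edge? (i , j) = (i <ᶠ? j) ×-dec adj? G i j

  edges-adj : ∀ {e} → e ∈ₗ edges G → uncurry (Adj G) e
  edges-adj e∈ = proj₂ (proj₂ (∈-filter⁻ edge? {xs = cartesianProduct (allFin n) (allFin n)} e∈))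

  ∈-edges⁺ : ∀ {i j} → i <ᶠ j → Adj G i j → (i , j) ∈ₗ edges G
  ∈-edges⁺ i<j ij = ∈-filter⁺ edge? (∈-cartesianProduct⁺ (∈-allFin _) (∈-allFin _)) (i<j , ij)

  edges-unique : Unique (edges G)
  edges-unique = Unique.filter⁺ edge? (Unique.cartesianProduct⁺ (Unique.allFin⁺ n) (Unique.allFin⁺ n))

  μ-attained : ∃[ M ] IsMatching G M × length M ≡ μ G
  μ-attained with ℕ-Extrema.argmax-sel id 0 (map length (matchings G))
  ... | inj₁ μ≡0 = [] , ([] , []) , sym μ≡0
  ... | inj₂ μ∈ with ∈-map⁻ length μ∈
  ...   | M , M∈ , μ≡ with ∈-filter⁻ (allPairs? (disjointEdges? G)) {xs = sublists (edges G)} M∈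
  ...     | M∈sub , dis =
    M , (All.tabulate (edges-adj ∘ sublists-⊆ (edges G) M∈sub) , dis) , sym μ≡

  DisjointEdges-sym : ∀ {e f} → DisjointEdges G e f → DisjointEdges G f e
  DisjointEdges-sym ((a≢c , a≢d) , (b≢c , b≢d)) =
    (≢-sym a≢c , ≢-sym b≢c) , (≢-sym a≢d , ≢-sym b≢d)

  same-or-disjoint : ∀ {M e f} → AllPairs (DisjointEdges G) M → e ∈ₗ M → f ∈ₗ M →
                     e ≡ f ⊎ DisjointEdges G e f
  same-or-disjoint (_ ∷ _)    (here refl) (here refl) = inj₁ refl
  same-or-disjoint (dis ∷ _)  (here refl) (there f∈)  = inj₂ (All.lookup dis f∈)
  same-or-disjoint (dis ∷ _)  (there e∈)  (here refl) = inj₂ (DisjointEdges-sym (All.lookup dis e∈))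
  same-or-disjoint (_ ∷ diss) (there e∈)  (there f∈)  = same-or-disjoint diss e∈ f∈

  -- Prepares the comparison with `edges`, where the smaller endpoint comes first. The clause on
  -- `Avoids` carries the disjointness from the head edge through the recursion.
  orientation : ∀ {M} → IsMatching G M → ∃[ M′ ]
    IsMatching G M′ × All (uncurry _<ᶠ_) M′ × length M ≡ length M′ × (∀ {v} → Avoids v M → Avoids v M′)
  orientation {[]} _ = [] , ([] , []) , [] , refl , λ _ → []
  orientation {(a , b) ∷ M} (ab ∷ adj , dis ∷ diss) with orientation {M} (adj , diss) | <-cmp a b
  ... | M′ , (adj′ , diss′) , ord , len , avoids | tri< a<b _ _ =
    (a , b) ∷ M′ ,
    (ab ∷ adj′ , All.zip (avoids (All.map proj₁ dis) , avoids (All.map proj₂ dis)) ∷ diss′) ,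
    a<b ∷ ord , cong suc len , λ { (v∉ab ∷ v∉M) → v∉ab ∷ avoids v∉M }
  ... | _ | tri≈ _ a≡b _ = contradiction a≡b (adj-≢ ab)
  ... | M′ , (adj′ , diss′) , ord , len , avoids | tri> _ _ b<a =
    (b , a) ∷ M′ ,
    (SimpleGraph.sym G ab ∷ adj′ , All.zip (avoids (All.map proj₂ dis) , avoids (All.map proj₁ dis)) ∷ diss′) ,
    b<a ∷ ord , cong suc len , λ { (v∉ab ∷ v∉M) → swap v∉ab ∷ avoids v∉M }

  -- After orientation only the order of the edges can differ from a sublist of `edges`; filtering
  -- `edges` by membership in the matching restores that order.
  μ-maximal : ∀ {M} → IsMatching G M → length M ≤ μ G
  μ-maximal isM with orientation isM
  ... | M , (adj , dis) , ord , len , _ = subst (_≤ μ G) (sym len) (≤-trans |M|≤|F| |F|≤μ)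
    where
    M? : U.Decidable (_∈ₗ M)
    M? e = Any.any? (≡-dec _≟ᶠ_ _≟ᶠ_ e) M

    F = filter M? (edges G)

    F∈matchings : F ∈ₗ matchings G
    F∈matchings = ∈-filter⁺ (allPairs? (disjointEdges? G)) (filter∈sublists M? (edges G))
      (allPairs-unique (Unique.filter⁺ M? (edges-unique)) λ e∈F f∈F e≢f →
        [ (λ e≡f → contradiction e≡f e≢f) , id ]′
          (same-or-disjoint dis (proj₂ (∈-filter⁻ M? {xs = edges G} e∈F))
                                  (proj₂ (∈-filter⁻ M? {xs = edges G} f∈F))))

    |F|≤μ : length F ≤ μ G
    |F|≤μ = All.lookup (ℕ-Extrema.xs≤max 0 (map length (matchings G))) (∈-map⁺ length F∈matchings)

    |M|≤|F| : length M ≤ length F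
    |M|≤|F| = length-⊆ (AllPairs.map (λ (c , _) e≡f → proj₁ c (cong proj₁ e≡f)) dis)
      λ e∈M → ∈-filter⁺ M? (∈-edges⁺ (All.lookup ord e∈M) (All.lookup adj e∈M)) e∈M

  -- Independent sets and the critical difference

  α-attained : ∃[ S ] Independent G S × ∣ S ∣ ≡ α G
  α-attained with ℕ-Extrema.argmax-sel id 0 (map ∣_∣ (filter (independent? G) (subsets n)))
  ... | inj₁ α≡0 = ⊥ , (λ u v u∈⊥ _ _ → ∉⊥ u∈⊥) , trans (∣⊥∣≡0 n) (sym α≡0)
  ... | inj₂ α∈ with ∈-map⁻ ∣_∣ α∈
  ...   | S , S∈ , α≡ = S , proj₂ (∈-filter⁻ (independent? G) {xs = subsets n} S∈) , sym α≡

  α-maximal : ∀ {S} → Independent G S → ∣ S ∣ ≤ α G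
  α-maximal {S} ind = All.lookup (ℕ-Extrema.xs≤max 0 _)
    (∈-map⁺ ∣_∣ (∈-filter⁺ (independent? G) (∈-subsets S) ind))

  ∈-N⁺ : ∀ {S u v} → u ∈ S → Adj G v u → v ∈ N G S
  ∈-N⁺ {S} u∈S vu = ∈-comprehension⁺ (neighbour? G S) (_ , u∈S , vu)

  ∈-N⁻ : ∀ {S v} → v ∈ N G S → ∃[ u ] u ∈ S × Adj G v u
  ∈-N⁻ {S} = ∈-comprehension⁻ (neighbour? G S)

  N⊆∁ : ∀ {S v} → Independent G S → v ∈ N G S → v ∈ ∁ S
  N⊆∁ ind v∈N with ∈-N⁻ v∈N
  ... | u , u∈S , vu = x∉p⇒x∈∁p λ v∈S → ind _ u v∈S u∈S vu

  -- A dart (a , b) contributes b to N A if a ∈ A, and a to ∁ A otherwise;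
  -- the vertices xs contribute themselves to ∁ A.
  matching-bound : ∀ {M xs} A → IsMatching G M → Unique xs → All (λ x → x ∉ A × Avoids x M) xs →
                   length xs + 2 * length M + ∣ A ∣ ≤ n + ∣ N G A ∣
  matching-bound {M} {xs} A isM@(adj , _) u out =
    ≤-from-sum ∣ ∁ A ∣ (+-mono-≤ (+-mono-≤ ins outs) (≤-reflexive (∣∁∣+∣∣≡n A)))
      (trans (cong (λ k → length xs + k + ∣ A ∣ + ∣ ∁ A ∣)
               (trans (sym (length-darts M)) (sym (length-filter-split A? (darts M)))))
             (lhs (length xs) (length L) (length L′) (∣ A ∣) (∣ ∁ A ∣)))
      (rhs (∣ N G A ∣) (∣ ∁ A ∣) n)
    where
    A? : U.Decidable (λ e → proj₁ e ∈ A)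
    A? e = proj₁ e ∈? A

    L  = filter A? (darts M)
    L′ = filter (¬? ∘ A?) (darts M)

    lhs : ∀ x l l′ a c → x + (l + l′) + a + c ≡ l + (x + l′) + (c + a)
    lhs = solve-∀

    rhs : ∀ k c m → k + c + m ≡ m + k + c
    rhs = solve-∀

    ins : length L ≤ ∣ N G A ∣
    ins = subst (_≤ ∣ N G A ∣) (length-map proj₂ L)
      (length≤∣∣ (unique-map-filter A? (proj₂ (darts-unique isM))) λ x∈ → target (∈-map⁻ proj₂ x∈))
      where
      target : ∀ {x} → ∃[ e ] e ∈ₗ L × x ≡ proj₂ e → x ∈ N G A
      target (e , e∈L , refl) with ∈-filter⁻ A? {xs = darts M} e∈L
      ... | e∈D , a∈A = ∈-N⁺ a∈A (SimpleGraph.sym G (All.lookup (all-darts (SimpleGraph.sym G) adj) e∈D))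

    outs : length xs + length L′ ≤ ∣ ∁ A ∣
    outs = subst (_≤ ∣ ∁ A ∣) (trans (length-++ xs) (cong (length xs +_) (length-map proj₁ L′)))
      (length≤∣∣
        (Unique.++⁺ u (unique-map-filter (¬? ∘ A?) (proj₁ (darts-unique isM))) disjoint)
        (x∉p⇒x∈∁p ∘ [ (λ x∈ → proj₁ (All.lookup out x∈)) , (λ x∈ → source (∈-map⁻ proj₁ x∈)) ]′ ∘ ∈-++⁻ xs))
      where
      source : ∀ {x} → ∃[ e ] e ∈ₗ L′ × x ≡ proj₁ e → x ∉ A
      source (e , e∈L′ , refl) = proj₂ (∈-filter⁻ (¬? ∘ A?) {xs = darts M} e∈L′)

      disjoint : Disjoint xs (map proj₁ L′)
      disjoint (x∈ , x∈′) with ∈-map⁻ proj₁ x∈′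
      ... | e , e∈L′ , x≡a = proj₁ (All.lookup (avoids-darts (proj₂ (All.lookup out x∈)))
        (proj₁ (∈-filter⁻ (¬? ∘ A?) {xs = darts M} e∈L′))) x≡a

  ∣N∣+∣∣≤n : ∀ {S} → Independent G S → ∣ N G S ∣ + ∣ S ∣ ≤ n
  ∣N∣+∣∣≤n {S} ind = subst (∣ N G S ∣ + ∣ S ∣ ≤_) (∣∁∣+∣∣≡n S)
    (+-monoˡ-≤ ∣ S ∣ (p⊆q⇒∣p∣≤∣q∣ (N⊆∁ ind)))

  -- Adding `2|M| + |S| ≤ n + |N(S)|` and `|N(S)| + |S| ≤ n` gives twice the claim.
  independent+matching≤n : ∀ {S M} → Independent G S → IsMatching G M → ∣ S ∣ + length M ≤ n
  independent+matching≤n {S} {M} ind isM = *-cancelˡ-≤ 2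
    (≤-from-sum ∣ N G S ∣ (+-mono-≤ (matching-bound S isM [] []) (∣N∣+∣∣≤n ind))
      (lhs (∣ S ∣) (length M) (∣ N G S ∣)) (rhs n (∣ N G S ∣)))
    where
    lhs : ∀ s m k → 2 * (s + m) + k ≡ 2 * m + s + (k + s)
    lhs = solve-∀
    rhs : ∀ m k → m + k + m ≡ 2 * m + k
    rhs = solve-∀

  α+μ≤n : α G + μ G ≤ n
  α+μ≤n with α-attained | μ-attained
  ... | S , ind , |S|≡α | M , isM , |M|≡μ =
    subst (_≤ n) (cong₂ _+_ |S|≡α |M|≡μ) (independent+matching≤n ind isM)

  difference≤d : ∀ A → difference G A ≤ᶻ d G
  difference≤d A = All.lookup (ℤ-Extrema.xs≤max 0ℤ (map (difference G) (subsets n)))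
    (∈-map⁺ (difference G) (∈-subsets A))

  ∣N⊥∣≡0 : ∣ N G ⊥ ∣ ≡ 0
  ∣N⊥∣≡0 = n≤0⇒n≡0 (subst (∣ N G ⊥ ∣ ≤_) (∣⊥∣≡0 n)
    (p⊆q⇒∣p∣≤∣q∣ {p = N G ⊥} {q = ⊥} λ v∈N → contradiction (proj₁ (proj₂ (∈-N⁻ v∈N))) ∉⊥))

  difference-⊥ : difference G ⊥ ≡ 0ℤ
  difference-⊥ = cong₂ _⊖_ (∣⊥∣≡0 n) ∣N⊥∣≡0

  -- No set has difference greater than n − 2|M|, the number of vertices that M misses.
  difference-maximal : ∀ {A M} → IsMatching G M → n + ∣ N G A ∣ ≤ ∣ A ∣ + 2 * length M →
                       difference G A ≡ d G
  difference-maximal {A} {M} isM h = ℤ.≤-antisym (difference≤d A)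
    -- The default value 0 of the maximum has to be bounded too; it is the difference of the empty
    -- set.
    (ℤ-Extrema.max≤v⁺ {xs = map (difference G) (subsets n)} (subst (_≤ᶻ difference G A) difference-⊥ (bound ⊥))
      (All.map⁺ (All.universal bound (subsets n))))
    where
    bound : ∀ B → difference G B ≤ᶻ difference G A
    bound B = ⊖-≤⁺ (∣ B ∣) (∣ N G B ∣) (∣ A ∣) (∣ N G A ∣)
      (≤-from-sum (2 * length M + n) (+-mono-≤ (matching-bound B isM [] []) h)
        (lhs (length M) (∣ B ∣) (∣ N G A ∣) n) (rhs (length M) (∣ N G B ∣) (∣ A ∣) n))
      where
      lhs : ∀ m b k n → b + k + (2 * m + n) ≡ 2 * m + b + (n + k)
      lhs = solve-∀
      rhs : ∀ m k a n → n + k + (a + 2 * m) ≡ a + k + (2 * m + n)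
      rhs = solve-∀

-- S and M certify that G is Kőnig–Egerváry, with S and M both maximum.
module _ (G : SimpleGraph n) {S : Subset n} {M : List (Fin n × Fin n)}
         (ind : Independent G S) (isM : IsMatching G M) (|S|+|M|≡n : ∣ S ∣ + length M ≡ n) where

  private
    n≤ : n ≤ ∣ S ∣ + length M
    n≤ = ≤-reflexive (sym |S|+|M|≡n)

  -- Independence gives `|N(S)| ≤ n − |S| = |M|`, so the difference of `S` is at least
  -- `|S| − |M| = n − 2|M|`.
  maximum-critical : IsCriticalIndependent G S
  maximum-critical = ind , difference-maximal G isM
    (≤-from-sum (∣ S ∣ + n) (+-mono-≤ (+-mono-≤ (∣N∣+∣∣≤n G ind) n≤) n≤)
      (lhs n (∣ N G S ∣) (∣ S ∣)) (rhs n (∣ S ∣) (length M)))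
    where
    lhs : ∀ n k s → n + k + (s + n) ≡ k + s + n + n
    lhs = solve-∀
    rhs : ∀ n s m → n + (s + m) + (s + m) ≡ s + 2 * m + (s + n)
    rhs = solve-∀

  -- A critical set omitting `v` would have difference at most `n − 2|M| − 1`, since `v` is an
  -- additional vertex outside it that `M` misses; but `S` reaches `n − 2|M|`.
  missed∈ker : ∀ {v} → Avoids v M → v ∈ ker G
  missed∈ker {v} v∉M = decidable-stable (v ∈? ker G) λ v∉ker →
    absurd (∉-⋂-filter⁻ (isCriticalIndependent? G) v∉ker)
    where
    absurd : ¬ (∃[ A ] IsCriticalIndependent G A × v ∉ A)
    -- The sum of all the inequalities is `1 + rest ≤ rest`.
    absurd (A , (_ , A-critical) , v∉A) = 1+n≰n (≤-from-sum {x = 1} {0} rest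
      (+-mono-≤ (+-mono-≤ (+-mono-≤ (+-mono-≤
        (⊖-≤⁻ (∣ S ∣) (∣ N G S ∣) (∣ A ∣) (∣ N G A ∣)
          (subst (difference G S ≤ᶻ_) (sym A-critical) (difference≤d G S)))
        (∣N∣+∣∣≤n G ind))
        (matching-bound G A isM ([] ∷ []) ((v∉A , v∉M) ∷ []))) n≤) n≤)
      (lhs n (∣ S ∣) (∣ N G A ∣) (∣ A ∣) (∣ N G S ∣) (length M)) refl)
      where
      rest : ℕ
      rest = ∣ A ∣ + ∣ N G S ∣ + n + (n + ∣ N G A ∣) + (∣ S ∣ + length M) + (∣ S ∣ + length M)

      lhs : ∀ n s k a l m → 1 + (a + l + n + (n + k) + (s + m) + (s + m))
                            ≡ s + k + (l + s) + (1 + 2 * m + a) + n + n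
      lhs = solve-∀

  -- The alternating paths run in the bipartite graph between `S` and its complement. A rerouting
  -- frees `v`; a blocked set `R` would make `S ∖ R` critical, although it omits `v`.
  ker-missable : ∀ {v} → v ∈ ker G → ∃[ M′ ] IsMatching G M′ × Avoids v M′ × length M ≤ length M′
  ker-missable {v} v∈ker =
    [ rerouted , (λ b → contradiction b ¬blocked) ]′
      (reroute-or-blocked E? (length L) L refl L-unique₁ L-crossing v)
    where
    S? : U.Decidable (λ e → proj₁ e ∈ S)
    S? e = proj₁ e ∈? S

    E : Rel (Fin n) 0ℓ
    E s b = Adj G s b × s ∈ S × b ∉ S

    E? : Decidable E
    E? s b = adj? G s b ×-dec (s ∈? S) ×-dec ¬? (b ∈? S)

    L  = filter S? (darts M)
    L′ = filter (¬? ∘ S?) (darts M)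

    L-unique₁ : Unique (map proj₁ L)
    L-unique₁ = unique-map-filter S? (proj₁ (darts-unique G isM))

    L-unique₂ : Unique (map proj₂ L)
    L-unique₂ = unique-map-filter S? (proj₂ (darts-unique G isM))

    L-crossing : All (uncurry E) L
    L-crossing = All.tabulate λ e∈L → crossing (∈-filter⁻ S? {xs = darts M} e∈L)
      where
      crossing : ∀ {e} → e ∈ₗ darts M × proj₁ e ∈ S → uncurry E e
      crossing (e∈D , a∈S) with All.lookup (all-darts (SimpleGraph.sym G) (proj₁ isM)) e∈D
      ... | ab = ab , a∈S , λ b∈S → ind _ _ a∈S b∈S ab

    |∁S|≤|M| : ∣ ∁ S ∣ ≤ length M
    |∁S|≤|M| = +-cancelʳ-≤ (∣ S ∣) _ _ (≤-reflexive
      (trans (∣∁∣+∣∣≡n S) (trans (sym |S|+|M|≡n) (+-comm (∣ S ∣) (length M)))))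

    -- Of the `2|M|` darts, at most `|∁ S| ≤ |M|` start outside `S`.
    |M|≤|L| : length M ≤ length L
    |M|≤|L| = ≤-from-sum (length L′) (+-monoʳ-≤ (length M) (≤-trans |L′|≤|∁S| |∁S|≤|M|)) refl
      (trans (double (length M)) (trans (sym (length-darts M)) (sym (length-filter-split S? (darts M)))))
      where
      double : ∀ m → m + m ≡ 2 * m
      double = solve-∀

      outside-S : ∀ {x} → ∃[ e ] e ∈ₗ L′ × x ≡ proj₁ e → x ∈ ∁ S
      outside-S (e , e∈L′ , refl) = x∉p⇒x∈∁p (proj₂ (∈-filter⁻ (¬? ∘ S?) {xs = darts M} e∈L′))

      |L′|≤|∁S| : length L′ ≤ ∣ ∁ S ∣
      |L′|≤|∁S| = subst (_≤ ∣ ∁ S ∣) (length-map proj₁ L′)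
        (length≤∣∣ (unique-map-filter (¬? ∘ S?) (proj₁ (darts-unique G isM))) (outside-S ∘ ∈-map⁻ proj₁))

    v∈S : v ∈ S
    v∈S = ∈-⋂-filter⁻ (isCriticalIndependent? G) v∈ker maximum-critical

    rerouted : Reroute E L v → ∃[ M′ ] IsMatching G M′ × Avoids v M′ × length M ≤ length M′
    rerouted (M′ , u₁ , es , v∉ , p) =
      M′ , (All.map proj₁ es , allPairs-unique (Unique.map⁻ u₁) disjoint) ,
      -- Rerouting frees `v` only as a first component; as a member of `S` it cannot be a second
      -- one.
      All.zipWith (λ (v≢a , (_ , _ , b∉S)) → v≢a , λ v≡b → b∉S (subst (_∈ S) v≡b v∈S)) (v∉ , es) ,
      ≤-trans |M|≤|L| (≤-reflexive
        (trans (sym (length-map proj₂ L)) (trans (sym (↭-length p)) (length-map proj₂ M′))))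
      where
      u₂ : Unique (map proj₂ M′)
      u₂ = Permutationₛ.Unique-resp-↭ (setoid (Fin n)) (↭⇒↭ₛ (↭-sym p)) L-unique₂

      -- Endpoints on the same side differ by uniqueness of the components, those on opposite sides
      -- by membership in `S`.
      disjoint : ∀ {e f} → e ∈ₗ M′ → f ∈ₗ M′ → e ≢ f → DisjointEdges G e f
      disjoint e∈ f∈ e≢f with All.lookup es e∈ | All.lookup es f∈
      ... | _ , a∈S , b∉S | _ , c∈S , d∉S =
          (e≢f ∘ map-unique-injective u₁ e∈ f∈ , λ a≡d → d∉S (subst (_∈ S) a≡d a∈S))
        , ((λ b≡c → b∉S (subst (_∈ S) (sym b≡c) c∈S)) , e≢f ∘ map-unique-injective u₂ e∈ f∈)

    ¬blocked : ¬ Blocked E L v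
    ¬blocked (R , v∈R , closed) =
      x∈∁p⇒x∉p (proj₂ (x∈p∩q⁻ S (∁ R) (∈-⋂-filter⁻ (isCriticalIndependent? G) v∈ker T-critical))) v∈R
      where
      T : Subset n
      T = S ∩ ∁ R

      T-independent : Independent G T
      T-independent u w u∈T w∈T = ind u w (proj₁ (x∈p∩q⁻ S (∁ R) u∈T)) (proj₁ (x∈p∩q⁻ S (∁ R) w∈T))

      |S|≤|T|+|R| : ∣ S ∣ ≤ ∣ T ∣ + ∣ R ∣
      |S|≤|T|+|R| = subst (∣ S ∣ ≤_)
        (trans (length-++ (elements T)) (cong₂ _+_ (length-elements T) (length-elements R)))
        (∣∣≤length split)
        where
        split : ∀ {x} → x ∈ S → x ∈ₗ elements T ++ elements R
        split {x} x∈S with x ∈? R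
        ... | yes x∈R = ∈-++⁺ʳ (elements T) (∈-elements⁺ x∈R)
        ... | no  x∉R = ∈-++⁺ˡ (∈-elements⁺ (x∈p∩q⁺ (x∈S , x∉p⇒x∈∁p x∉R)))

      R? : U.Decidable (λ e → proj₁ e ∈ R)
      R? e = proj₁ e ∈? R

      F = filter R? L

      |R|≤|F| : ∣ R ∣ ≤ length F
      |R|≤|F| = subst (∣ R ∣ ≤_) (length-map proj₁ F) (∣∣≤length λ r∈R →
        ∈-map⁺ proj₁ (∈-filter⁺ R? (proj₁ (proj₂ (closed r∈R))) r∈R))

      -- The partners of `R` and the neighbours of `T` are disjoint parts of the complement of `S`:
      -- every neighbour in `S` of such a partner belongs to `R`, hence not to `T`.
      |F|+|NT|≤|∁S| : length F + ∣ N G T ∣ ≤ ∣ ∁ S ∣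
      |F|+|NT|≤|∁S| = subst (_≤ ∣ ∁ S ∣)
        (trans (length-++ (map proj₂ F)) (cong₂ _+_ (length-map proj₂ F) (length-elements (N G T))))
        (length≤∣∣ (Unique.++⁺ (unique-map-filter R? L-unique₂) (elements-unique (N G T)) disjoint)
          ([ (λ x∈ → mate∈∁S (∈-map⁻ proj₂ x∈)) , (λ x∈ → NT⊆∁S (∈-N⁻ G (∈-elements⁻ (N G T) x∈))) ]′
            ∘ ∈-++⁻ (map proj₂ F)))
        where
        mate∉S : ∀ {e} → e ∈ₗ F → proj₂ e ∉ S
        mate∉S e∈F = proj₂ (proj₂ (All.lookup L-crossing (proj₁ (∈-filter⁻ R? {xs = L} e∈F))))

        mate∈∁S : ∀ {x} → ∃[ e ] e ∈ₗ F × x ≡ proj₂ e → x ∈ ∁ S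
        mate∈∁S (e , e∈F , refl) = x∉p⇒x∈∁p (mate∉S e∈F)

        NT⊆∁S : ∀ {x} → ∃[ u ] u ∈ T × Adj G x u → x ∈ ∁ S
        NT⊆∁S (u , u∈T , xu) =
          x∉p⇒x∈∁p λ x∈S → ind _ u x∈S (proj₁ (x∈p∩q⁻ S (∁ R) u∈T)) xu

        disjoint : Disjoint (map proj₂ F) (elements (N G T))
        disjoint (x∈F , x∈NT) with ∈-map⁻ proj₂ x∈F | ∈-N⁻ G (∈-elements⁻ (N G T) x∈NT)
        ... | e , e∈F , refl | u , u∈T , bu with ∈-filter⁻ R? {xs = L} e∈F | x∈p∩q⁻ S (∁ R) u∈T
        ...   | e∈L , r∈R | u∈S , u∈∁R with closed r∈R
        -- The partner supplied by `closed` is the second endpoint of `e`, since first components in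
        -- `L` are distinct.
        ...     | b , rb∈L , absorbs = x∈∁p⇒x∉p u∈∁R (absorbs
          (subst (Adj G u) (cong proj₂ (map-unique-injective L-unique₁ e∈L rb∈L refl)) (SimpleGraph.sym G bu) ,
           u∈S , subst (_∉ S) (cong proj₂ (map-unique-injective L-unique₁ e∈L rb∈L refl)) (mate∉S e∈F)))

      -- Passing from `S` to `T` loses at most `|R|` vertices, while `|N(T)| ≤ |M| − |R|`; the
      -- difference is thus still at least `|S| − |M| = n − 2|M|`.
      T-critical : IsCriticalIndependent G T
      T-critical = T-independent , difference-maximal G isM
        (≤-from-sum (∣ S ∣ + ∣ R ∣)
          (+-mono-≤ (+-mono-≤ |S|≤|T|+|R|
            (≤-trans (+-monoˡ-≤ (∣ N G T ∣) |R|≤|F|) (≤-trans |F|+|NT|≤|∁S| |∁S|≤|M|))) n≤)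
          (lhs n (∣ N G T ∣) (∣ S ∣) (∣ R ∣)) (rhs (∣ T ∣) (∣ R ∣) (∣ S ∣) (length M)))
        where
        lhs : ∀ n k s r → n + k + (s + r) ≡ s + (r + k) + n
        lhs = solve-∀
        rhs : ∀ a r s m → a + r + m + (s + m) ≡ a + 2 * m + (s + r)
        rhs = solve-∀

-- Vertex deletion

module _ {m : ℕ} (G : SimpleGraph (suc m)) (v : Fin (suc m)) where

  private
    H = delete G v
    ι = punchIn v

  preimage : Subset (suc m) → Subset m
  preimage S = comprehension (λ j → ι j ∈? S)

  image? : ∀ S → U.Decidable (λ x → ∃[ j ] (x ≡ ι j × j ∈ S))
  image? S x = any? λ j → (x ≟ᶠ ι j) ×-dec (j ∈? S)

  image : Subset m → Subset (suc m)
  image S = comprehension (image? S)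

  v∉image : ∀ S → v ∉ image S
  v∉image S v∈ with ∈-comprehension⁻ (image? S) v∈
  ... | j , v≡ιj , _ = punchInᵢ≢i v j (sym v≡ιj)

  image-independent : ∀ {S} → Independent H S → Independent G (image S)
  image-independent {S} ind x y x∈ y∈ with ∈-comprehension⁻ (image? S) x∈ | ∈-comprehension⁻ (image? S) y∈
  ... | i , refl , i∈S | j , refl , j∈S = ind i j i∈S j∈S

  preimage-independent : ∀ {S} → Independent G S → Independent H (preimage S)
  preimage-independent {S} ind i j i∈ j∈ =
    ind (ι i) (ι j) (∈-comprehension⁻ (λ j → ι j ∈? S) i∈) (∈-comprehension⁻ (λ j → ι j ∈? S) j∈)

  ∣image∣ : ∀ S → ∣ S ∣ ≤ ∣ image S ∣
  ∣image∣ S = subst (_≤ ∣ image S ∣) (trans (length-map ι (elements S)) (length-elements S))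
    (length≤∣∣ (Unique.map⁺ (punchIn-injective v _ _) (elements-unique S)) (into ∘ ∈-map⁻ ι))
    where
    into : ∀ {x} → ∃[ j ] j ∈ₗ elements S × x ≡ ι j → x ∈ image S
    into (j , j∈ , x≡ιj) = ∈-comprehension⁺ (image? S) (j , x≡ιj , ∈-elements⁻ S j∈)

  ∈-map-preimage : ∀ {S x} → v ≢ x → x ∈ S → x ∈ₗ map ι (elements (preimage S))
  ∈-map-preimage {S} v≢x x∈S = subst (_∈ₗ map ι (elements (preimage S))) (punchIn-punchOut v≢x)
    (∈-map⁺ ι (∈-elements⁺ (∈-comprehension⁺ (λ j → ι j ∈? S)
      (subst (_∈ S) (sym (punchIn-punchOut v≢x)) x∈S))))

  length-map-preimage : ∀ S → length (map ι (elements (preimage S))) ≡ ∣ preimage S ∣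
  length-map-preimage S = trans (length-map ι (elements (preimage S))) (length-elements (preimage S))

  ∣∣≤∣preimage∣ : ∀ {S} → v ∉ S → ∣ S ∣ ≤ ∣ preimage S ∣
  ∣∣≤∣preimage∣ {S} v∉S = subst (∣ S ∣ ≤_) (length-map-preimage S)
    (∣∣≤length λ x∈S → ∈-map-preimage (λ { refl → v∉S x∈S }) x∈S)

  ∣∣≤1+∣preimage∣ : ∀ S → ∣ S ∣ ≤ suc (∣ preimage S ∣)
  ∣∣≤1+∣preimage∣ S = subst (∣ S ∣ ≤_) (cong suc (length-map-preimage S)) (∣∣≤length split)
    where
    split : ∀ {x} → x ∈ S → x ∈ₗ v ∷ map ι (elements (preimage S))
    split {x} x∈S with v ≟ᶠ x
    ... | yes refl = here refl
    ... | no  v≢x  = there (∈-map-preimage v≢x x∈S)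

  ∣∣≤α-delete : ∀ {S} → Independent G S → v ∉ S → ∣ S ∣ ≤ α H
  ∣∣≤α-delete ind v∉S = ≤-trans (∣∣≤∣preimage∣ v∉S) (α-maximal H (preimage-independent ind))

  α≤1+α-delete : α G ≤ suc (α H)
  α≤1+α-delete with α-attained G
  ... | S , ind , |S|≡α = subst (_≤ suc (α H)) |S|≡α
    (≤-trans (∣∣≤1+∣preimage∣ S) (s≤s (α-maximal H (preimage-independent ind))))

  -- With equal independence numbers, the image of a maximum independent set of `H` would be one of
  -- `G` that omits `v`.
  core⇒α-delete<α : v ∈ core G → α H < α G
  core⇒α-delete<α v∈core with α-attained H
  ... | S , ind , |S|≡α = ≤∧≢⇒< αH≤ λ αH≡αG → v∉image S
    (∈-⋂-filter⁻ (isMaximumIndependent? G) v∈core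
      (image-independent ind , ≤-antisym (α-maximal G (image-independent ind))
        (subst (_≤ ∣ image S ∣) (trans |S|≡α αH≡αG) (∣image∣ S))))
    where
    αH≤ : α H ≤ α G
    αH≤ = subst (_≤ α G) |S|≡α (≤-trans (∣image∣ S) (α-maximal G (image-independent ind)))

  ι² : Fin m × Fin m → Fin (suc m) × Fin (suc m)
  ι² (i , j) = ι i , ι j

  matching-extend : ∀ {M} → IsMatching H M → IsMatching G (map ι² M) × Avoids v (map ι² M)
  matching-extend (adj , dis) =
      (All.map⁺ adj , AllPairs.map⁺ (AllPairs.map
        (λ ((p , q) , (r , s)) → (p ∘ inj , q ∘ inj) , (r ∘ inj , s ∘ inj)) dis))
    , All.map⁺ (All.map (λ {e} _ → ≢-sym (punchInᵢ≢i v (proj₁ e)) , ≢-sym (punchInᵢ≢i v (proj₂ e))) adj)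
    where
    inj : ∀ {i j} → ι i ≡ ι j → i ≡ j
    inj = punchIn-injective v _ _

  avoids⇒map : ∀ {M} → Avoids v M → ∃[ M′ ] map ι² M′ ≡ M
  avoids⇒map []                    = [] , refl
  avoids⇒map ((v≢a , v≢b) ∷ v∉M) with avoids⇒map v∉M
  ... | M′ , refl = (punchOut v≢a , punchOut v≢b) ∷ M′ ,
    cong (_∷ map ι² M′) (cong₂ _,_ (punchIn-punchOut v≢a) (punchIn-punchOut v≢b))

  length≤μ-delete : ∀ {M} → IsMatching G M → Avoids v M → length M ≤ μ H
  length≤μ-delete (adj , dis) v∉M with avoids⇒map v∉M
  ... | M′ , refl = subst (_≤ μ H) (sym (length-map ι² M′))
    (μ-maximal H (All.map⁻ adj , AllPairs.map
      (λ ((p , q) , (r , s)) → (p ∘ cong ι , q ∘ cong ι) , (r ∘ cong ι , s ∘ cong ι)) (AllPairs.map⁻ dis)))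

  μ≤1+μ-delete : μ G ≤ suc (μ H)
  μ≤1+μ-delete with μ-attained G
  ... | M , (adj , dis) , |M|≡μ = subst (_≤ suc (μ H)) |M|≡μ
    (≤-trans (at-most-one dis) (s≤s (length≤μ-delete
      (All.filter⁺ avoids? adj , AllPairs.filter⁺ avoids? dis) (All.all-filter avoids? M))))
    where
    avoids? : U.Decidable (λ (a , b) → v ≢ a × v ≢ b)
    avoids? (a , b) = ¬? (v ≟ᶠ a) ×-dec ¬? (v ≟ᶠ b)

    at-most-one : ∀ {M} → AllPairs (DisjointEdges G) M → length M ≤ suc (length (filter avoids? M))
    at-most-one [] = z≤n
    at-most-one {(a , b) ∷ M} (dis ∷ diss) with v ≟ᶠ a | v ≟ᶠ b
    -- Once the edge at `v` is met, disjointness lets all remaining edges pass the filter.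
    ... | yes refl | _        = ≤-reflexive (cong (suc ∘ length) (sym (filter-all avoids? (All.map proj₁ dis))))
    ... | no _     | yes refl = ≤-reflexive (cong (suc ∘ length) (sym (filter-all avoids? (All.map proj₂ dis))))
    ... | no _     | no _     = s≤s (at-most-one diss)

  module _ (ke : KönigEgerváry G) where

    -- Some maximum independent set survives the deletion, and the matching number drops by at most
    -- one.
    ∉core⇒delete-KE : v ∉ core G → KönigEgerváry H
    ∉core⇒delete-KE v∉core with ∉-⋂-filter⁻ (isMaximumIndependent? G) v∉core
    ... | S , (ind , |S|≡α) , v∉S = ≤-antisym (α+μ≤n H) (s≤s⁻¹ (≤-trans (≤-reflexive (sym ke))
      (≤-trans (+-mono-≤ (subst (_≤ α H) |S|≡α (∣∣≤α-delete ind v∉S)) μ≤1+μ-delete)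
               (≤-reflexive (+-suc (α H) (μ H))))))

    -- Some maximum matching misses `v` and survives the deletion, and the independence number drops
    -- by at most one.
    ∈ker⇒delete-KE : v ∈ ker G → KönigEgerváry H
    ∈ker⇒delete-KE v∈ker with α-attained G | μ-attained G
    ... | S , ind , |S|≡α | M , isM , |M|≡μ
      with ker-missable G ind isM (trans (cong₂ _+_ |S|≡α |M|≡μ) ke) v∈ker
    ...   | M′ , isM′ , v∉M′ , |M|≤|M′| =
      ≤-antisym (α+μ≤n H) (s≤s⁻¹ (≤-trans (≤-reflexive (sym ke))
        (+-mono-≤ α≤1+α-delete (subst (_≤ μ H) |M|≡μ (≤-trans |M|≤|M′| (length≤μ-delete isM′ v∉M′))))))

    -- Here the independence number drops by exactly one. Were `H` Kőnig-Egerváry, a maximum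
    -- matching of `H` would therefore be large enough to certify `G` together with `S`, and it
    -- misses `v`, which would force `v` into `ker`.
    core─ker⇒delete-¬KE : v ∈ core G → v ∉ ker G → ¬ KönigEgerváry H
    core─ker⇒delete-¬KE v∈core v∉ker keH with α-attained G | μ-attained H
    ... | S , ind , |S|≡α | M , isM , |M|≡μH with matching-extend isM
    ...   | isM′ , v∉M′ = v∉ker (missed∈ker G ind isM′ tight v∉M′)
      where
      tight : ∣ S ∣ + length (map ι² M) ≡ suc m
      tight = trans (cong₂ _+_ (trans |S|≡α (≤-antisym α≤1+α-delete (core⇒α-delete<α v∈core)))
                               (trans (length-map ι² M) |M|≡μH))
                    (cong suc keH)

    -- Both parameters drop by at most one, so the deficiency of `H` is at most one; it is not zero
    -- by the previous lemma.
    core─ker⇒delete-1KE : v ∈ core G → v ∉ ker G → 1-KönigEgerváry H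
    core─ker⇒delete-1KE v∈core v∉ker = ≤-antisym
      (≤∧≢⇒< (α+μ≤n H) (core─ker⇒delete-¬KE v∈core v∉ker))
      (s≤s⁻¹ (≤-trans (≤-reflexive (sym ke)) (≤-trans (+-mono-≤ α≤1+α-delete μ≤1+μ-delete)
        (≤-reflexive (cong suc (+-suc (α H) (μ H)))))))

-- The inclusion of `ker` in `core` and the final count

-- Every maximum independent set is critical, as a maximum matching certifies.
ker⊆core : (G : SimpleGraph n) → KönigEgerváry G → ∀ {v} → v ∈ ker G → v ∈ core G
ker⊆core G ke {v} v∈ker = decidable-stable (v ∈? core G) λ v∉core →
  absurd (∉-⋂-filter⁻ (isMaximumIndependent? G) v∉core)
  where
  absurd : ¬ (∃[ S ] IsMaximumIndependent G S × v ∉ S)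
  absurd (S , (ind , |S|≡α) , v∉S) with μ-attained G
  ... | M , isM , |M|≡μ = v∉S (∈-⋂-filter⁻ (isCriticalIndependent? G) v∈ker
    (maximum-critical G ind isM (trans (cong₂ _+_ |S|≡α |M|≡μ) ke)))

theorem3p2 : (n : ℕ) (G : SimpleGraph n) → KönigEgerváry G →
    ((v : Fin n) → v ∉ core G → KönigEgerváry (delete G v))
    × ((v : Fin n) → v ∈ core G → v ∉ ker G →
    ¬ KönigEgerváry (delete G v) × 1-KönigEgerváry (delete G v))
    × ((v : Fin n) → v ∈ ker G → KönigEgerváry (delete G v))
    × ϱᵥ G ≡ (n ∸ ξ G) + ε G
theorem3p2 n G ke = i n G ke , ii n G ke , iii n G ke ,
  -- The vertices counted by `ϱᵥ` form the disjoint union of the complement of `core` and of `ker`.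
  trans (∣∣-union split
          (∈-comprehension⁺ KE? ∘ i n G ke _ ∘ x∈∁p⇒x∉p)
          (∈-comprehension⁺ KE? ∘ iii n G ke _)
          (λ v∈∁core v∈ker → x∈∁p⇒x∉p v∈∁core (ker⊆core G ke v∈ker)))
        (cong (_+ ε G) (∣∁p∣≡n∸∣p∣ (core G)))
  where
  -- The order is an argument so that it can be matched as a successor, where `delete` computes; a
  -- graph of order zero has no vertex to delete.
  i : ∀ n (G : SimpleGraph n) → KönigEgerváry G →
      ∀ v → v ∉ core G → KönigEgerváry (delete G v)
  i (suc _) G ke v = ∉core⇒delete-KE G v ke

  ii : ∀ n (G : SimpleGraph n) → KönigEgerváry G → ∀ v → v ∈ core G → v ∉ ker G →
       ¬ KönigEgerváry (delete G v) × 1-KönigEgerváry (delete G v)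
  ii (suc _) G ke v v∈core v∉ker =
    core─ker⇒delete-¬KE G v ke v∈core v∉ker , core─ker⇒delete-1KE G v ke v∈core v∉ker

  iii : ∀ n (G : SimpleGraph n) → KönigEgerváry G →
        ∀ v → v ∈ ker G → KönigEgerváry (delete G v)
  iii (suc _) G ke v = ∈ker⇒delete-KE G v ke

  KE? : U.Decidable (λ v → KönigEgerváry (delete G v))
  KE? v = könig-egerváry? (delete G v)

  split : ∀ {v} → v ∈ comprehension KE? → v ∈ ∁ (core G) ⊎ v ∈ ker G
  split {v} v∈ with v ∈? core G | v ∈? ker G
  ... | no v∉core  | _         = inj₁ (x∉p⇒x∈∁p v∉core)
  ... | yes _      | yes v∈ker = inj₂ v∈ker
  ... | yes v∈core | no v∉ker  =
    contradiction (∈-comprehension⁻ KE? v∈) (proj₁ (ii n G ke v v∈core v∉ker))
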